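{- $2\times4$ integer matrices may have arbitrarily large Markov complexity: for every positive integer $N$ there exists $A\in\mathbb{Z}^{2\times4}$ with $m(A)\ge N$.
   Context: For $A\in\mathbb{Z}^{m\times n}$ and $r\ge2$, the $r$-th Lawrence lifting $A^{(r)}$ is the $(rm+n)\times rn$ matrix with $r$ copies of $A$ on the block diagonal and final block row $(I_n\ I_n\ \cdots\ I_n)$. Elements of $\operatorname{Ker}_{\mathbb{Z}}(A^{(r)})$ are identified with $r\times n$ integer matrices whose rows lie in $\operatorname{Ker}_{\mathbb{Z}}(A)$ and sum to zero; the type of such an element is its number of nonzero rows. For an integer matrix $M$ with $N'$ columns, a Markov basis is a finite set $\mathcal{M}\subseteq\operatorname{Ker}_{\mathbb{Z}}(M)$ such that whenever $\mathbf{w},\mathbf{u}\in\mathbb{N}^{N'}$ with $\mathbf{w}-\mathbf{u}\in\operatorname{Ker}_{\mathbb{Z}}(M)$ there exist $\mathbf{v}_1,\ldots,\mathbf{v}_p\in\mathcal{M}\cup(-\mathcal{M})$ with $\mathbf{w}-\sum_{i\le l}\mathbf{v}_i\in\mathbb{N}^{N'}$ for all $l$ and $\mathbf{w}-\mathbf{u}=\sum_{i=1}^p\mathbf{v}_i$; it is minimal if no proper subset is a Markov basis. The universal Markov basis of $M$ is the union of all minimal Markov bases (vectors differing by sign identified). The Markov complexity $m(A)$ is the largest type of any element of the universal Markov basis of $A^{(r)}$, as $r\ge2$ varies. -}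

module Defs where

open import Data.Nat using (ℕ; zero; suc; _*_) renaming (_+_ to _+ℕ_)
open import Data.Fin using (Fin; _≟_)
open import Data.Integer as ℤ using (ℤ; +_; _-_; _≤_) renaming (_+_ to _+ℤ_; _*_ to _*ℤ_; -_ to −_)
import Data.Integer.Properties as ℤP
open import Data.Vec using (Vec; []; _∷_; map; zipWith; foldr; replicate; tabulate; concat; _++_; take; drop; count)
open import Data.Vec.Properties using (≡-dec)
import Data.Vec.Relation.Unary.All as VAll
open import Data.List using (List; []; _∷_)
open import Data.List.Relation.Unary.All using (All)
open import Data.List.Membership.Propositional using (_∈_; _∉_)
open import Data.Product using (Σ; _×_; ∃-syntax)
open import Data.Sum using (_⊎_)
open import Data.Unit using (⊤)
open import Relation.Nullary using (¬_; ¬?; does)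
open import Relation.Binary.PropositionalEquality using (_≡_)
open import Data.Bool using (if_then_else_)

Matrix : ℕ → ℕ → Set
Matrix m n = Vec (Vec ℤ n) m

ZVec : ℕ → Set
ZVec N = Vec ℤ N

0ᵥ : ∀ {N} → ZVec N
0ᵥ {N} = replicate N (+ 0)

_+ᵥ_ : ∀ {N} → ZVec N → ZVec N → ZVec N
_+ᵥ_ = zipWith _+ℤ_

_-ᵥ_ : ∀ {N} → ZVec N → ZVec N → ZVec N
_-ᵥ_ = zipWith _-_

negᵥ : ∀ {N} → ZVec N → ZVec N
negᵥ = map −_

dot : ∀ {N} → ZVec N → ZVec N → ℤ
dot u v = foldr _ _+ℤ_ (+ 0) (zipWith _*ℤ_ u v)

_·_ : ∀ {K N} → Matrix K N → ZVec N → ZVec K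
M · v = map (λ row → dot row v) M

InKer : ∀ {K N} → Matrix K N → ZVec N → Set
InKer M v = M · v ≡ 0ᵥ

Nonneg : ∀ {N} → ZVec N → Set
Nonneg v = VAll.All (λ z → + 0 ≤ z) v

toℤᵥ : ∀ {N} → Vec ℕ N → ZVec N
toℤᵥ = map (λ k → + k)

sumᵥ : ∀ {N} → List (ZVec N) → ZVec N
sumᵥ []       = 0ᵥ
sumᵥ (v ∷ vs) = v +ᵥ sumᵥ vs

StaysNonneg : ∀ {N} → ZVec N → List (ZVec N) → Set
StaysNonneg x []       = ⊤
StaysNonneg x (v ∷ vs) = Nonneg (x -ᵥ v) × StaysNonneg (x -ᵥ v) vs

IsMarkovBasis : ∀ {K N} → Matrix K N → List (ZVec N) → Set
IsMarkovBasis {K} {N} M 𝓜 =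
  All (InKer M) 𝓜 ×
  ((w u : Vec ℕ N) → InKer M (toℤᵥ w -ᵥ toℤᵥ u) →
    ∃[ vs ] (All (λ v → v ∈ 𝓜 ⊎ negᵥ v ∈ 𝓜) vs
             × StaysNonneg (toℤᵥ w) vs
             × (toℤᵥ w -ᵥ toℤᵥ u ≡ sumᵥ vs)))

IsMinimalMarkovBasis : ∀ {K N} → Matrix K N → List (ZVec N) → Set
IsMinimalMarkovBasis {K} {N} M 𝓜 =
  IsMarkovBasis M 𝓜 ×
  ((𝓢 : List (ZVec N)) → All (_∈ 𝓜) 𝓢 → (∃[ x ] (x ∈ 𝓜 × x ∉ 𝓢)) →
    ¬ IsMarkovBasis M 𝓢)

-- v belongs to the universal Markov basis (union of all minimal Markov
-- bases, vectors differing by sign identified).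
InUniversalMarkovBasis : ∀ {K N} → Matrix K N → ZVec N → Set
InUniversalMarkovBasis {K} {N} M v =
  ∃[ 𝓜 ] (IsMinimalMarkovBasis M 𝓜 × (v ∈ 𝓜 ⊎ negᵥ v ∈ 𝓜))

unitᵥ : ∀ {n} → Fin n → ZVec n
unitᵥ j = tabulate (λ k → if does (j ≟ k) then + 1 else + 0)

-- r-th Lawrence lifting: (r*m + n) × (r*n) matrix, with r copies of A on the
-- block diagonal and final block row (I_n I_n … I_n).  Column (l, j)
-- (block l ∈ Fin r, j ∈ Fin n) is coordinate l*n + j.
lawrence : ∀ {m n} (r : ℕ) → Matrix m n → Matrix (r * m +ℕ n) (r * n)
lawrence {m} {n} r A = diagRows ++ idRows
  where
  diagRows : Matrix (r * m) (r * n)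
  diagRows = concat (tabulate λ (k : Fin r) → map (λ row →
               concat (tabulate λ (l : Fin r) →
                 if does (k ≟ l) then row else replicate n (+ 0))) A)
  idRows : Matrix n (r * n)
  idRows = tabulate λ (j : Fin n) → concat (replicate r (unitᵥ j))

-- Split a vector of ℤ^{r n} into its r consecutive blocks of length n
-- (the rows of the associated r × n matrix).
blocks : ∀ {n} (r : ℕ) → ZVec (r * n) → Vec (ZVec n) r
blocks zero    v = []
blocks {n} (suc r) v = take n v ∷ blocks r (drop n v)

type : ∀ {n} (r : ℕ) → ZVec (r * n) → ℕ
type {n} r v = count (λ row → ¬? (≡-dec ℤ._≟_ row 0ᵥ)) (blocks r v)

{-# OPTIONS --safe #-}
module Submission where

-- Take A = (1 1 1 1 ; 0 1 k+1 k+2).  The kernel vectors s = (−k, k+1, −1, 0),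
-- t = (0, −1, k+1, −k) and p = (1, −1, −1, 1) satisfy s + t + k p = 0, so s, t and k
-- copies of p are the rows of an element v of type k + 2.  The fibre of each of s⁺, t⁺, p⁺
-- under A has exactly two points, and equality of the first and last column sums forces all
-- rows to be switched simultaneously; hence the fibre of v⁺ under the Lawrence lifting is
-- {v⁺ , v⁻}, and v or −v lies in every Markov basis.
--
-- It remains to construct some minimal Markov basis.  By Gordan's lemma the monoid
-- {(w , u) : M w = M u} has a finite generating set H, and the differences p − q over
-- (p , q) ∈ H form a Markov basis.  A finite set of kernel vectors is a Markov basis iff it
-- connects p to q for each (p , q) ∈ H, which is decidable because fibres of a Lawrence
-- lifting are finite; so redundant elements can be discarded one at a time.

open import Defs
open import Algebra.Bundles using (CommutativeMonoid)
import Algebra.Solver.CommutativeMonoid as CMSolver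
open import Algebra.Structures using (IsCommutativeMonoid)
open import Data.Bool using (if_then_else_)
open import Data.Fin as Fin using (Fin; zero; suc; #_)
open import Data.Integer as ℤ using (ℤ; +_)
import Data.Integer.Properties as ℤP
import Data.Integer.Tactic.RingSolver as ℤSolver
open import Data.List as List using (List; []; _∷_)
open import Data.List.Membership.Propositional using (_∈_; find; lose)
open import Data.List.Membership.Propositional.Properties
  using (∈-++⁺ˡ; ∈-++⁺ʳ; ∈-filter⁺; ∈-cartesianProductWith⁺; ∈-map⁺; ∈-upTo⁺)
import Data.List.Properties as ListP
open import Data.List.Relation.Unary.All as All using (All; []; _∷_)
import Data.List.Relation.Unary.All.Properties as AllP
open import Data.List.Relation.Unary.Any as Any using (here; there; any?)
open import Data.Nat as ℕ using (ℕ; zero; suc; _≤_)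
open import Data.Nat.Induction using (<-wellFounded)
import Data.Nat.Properties as ℕP
import Data.Nat.Tactic.RingSolver as ℕSolver
open import Data.Product using (Σ; _×_; ∃-syntax; _,_; proj₁; proj₂)
open import Data.Sum as Sum using (_⊎_; inj₁; inj₂)
open import Data.Unit using (tt)
open import Data.Vec as Vec using (Vec; []; _∷_; _++_; concat; tabulate; replicate; lookup; zipWith)
import Data.Vec.Properties as VecP
open import Data.Vec.Relation.Unary.All as VAll using ([]; _∷_)
import Data.Vec.Relation.Unary.All.Properties as VAllP
open import Function using (_∘_; id)
open import Induction.WellFounded using (Acc; acc)
open import Level using (0ℓ)
open import Relation.Binary.Construct.Closure.ReflexiveTransitive using (Star; ε; _◅_; _◅◅_; gmap)
open import Relation.Binary.Definitions using (Decidable; DecidableEquality)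
open import Relation.Binary.PropositionalEquality
open import Relation.Nullary using (¬?; Dec; yes; no; does; contradiction)
open import Relation.Nullary.Decidable using (_×-dec_; _⊎-dec_; map′)
import Relation.Unary as Unary

-- Gordan's lemma for finitely generated commutative monoids

module Gordan {C : Set} {_∙_ : C → C → C} {ε : C}
              (isCM : IsCommutativeMonoid _≡_ _∙_ ε) where

  private
    monoid : CommutativeMonoid 0ℓ 0ℓ
    monoid = record { isCommutativeMonoid = isCM }

    module CM = CommutativeMonoid monoid
    open CMSolver monoid using (solve; _⊕_; _⊜_)

  total : List C → C
  total = List.foldr _∙_ ε

  Span : List C → C → Set
  Span G x = ∃[ l ] (All (_∈ G) l × total l ≡ x)

  total-++ : ∀ xs ys → total (xs List.++ ys) ≡ total xs ∙ total ys
  total-++ []       ys = sym (CM.identityˡ _)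
  total-++ (x ∷ xs) ys = trans (cong (x ∙_) (total-++ xs ys)) (sym (CM.assoc x _ _))

  Span-∙ : ∀ {G x y} → Span G x → Span G y → Span G (x ∙ y)
  Span-∙ (l , l∈ , refl) (m , m∈ , refl) = l List.++ m , AllP.++⁺ l∈ m∈ , total-++ l m

  record Functional : Set where
    field
      _⟨_⟩ : C → ℤ
      ε-homo : _⟨_⟩ ε ≡ + 0
      ∙-homo : ∀ x y → _⟨_⟩ (x ∙ y) ≡ _⟨_⟩ x ℤ.+ _⟨_⟩ y

  open Functional public

  negate : Functional → Functional
  negate f = record
    { _⟨_⟩ = λ x → ℤ.- f ⟨ x ⟩
    ; ε-homo = cong ℤ.-_ (ε-homo f)
    ; ∙-homo = λ x y → trans (cong ℤ.-_ (∙-homo f x y)) (ℤP.neg-distrib-+ (f ⟨ x ⟩) (f ⟨ y ⟩))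
    }

  -- The two ends of the interval vary separately, because one lowering step shortens only one of
  -- them.
  Within : Functional → ℕ → ℕ → C → Set
  Within f b a x = (ℤ.- + b) ℤ.≤ f ⟨ x ⟩ × f ⟨ x ⟩ ℤ.≤ + a

  Within? : ∀ f b a x → Dec (Within f b a x)
  Within? f b a x = (_ ℤ.≤? _) ×-dec (_ ℤ.≤? _)

  Within-negate : ∀ f {b a x} → Within f b a x → Within (negate f) a b x
  Within-negate f {b} (lo , hi) =
    ℤP.neg-mono-≤ hi , subst (_ ℤ.≤_) (ℤP.neg-involutive (+ b)) (ℤP.neg-mono-≤ lo)

  Within-unnegate : ∀ f {b a x} → Within (negate f) b a x → Within f a b x
  Within-unnegate f {x = x} w with lo , hi ← Within-negate (negate f) {x = x} w =
    subst (_ ℤ.≤_) (ℤP.neg-involutive _) lo , subst (ℤ._≤ _) (ℤP.neg-involutive _) hi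

  nonneg-total : ∀ f {l} → All (λ x → + 0 ℤ.≤ f ⟨ x ⟩) l → + 0 ℤ.≤ f ⟨ total l ⟩
  nonneg-total f [] = ℤP.≤-reflexive (sym (ε-homo f))
  nonneg-total f (px ∷ pl) =
    subst (+ 0 ℤ.≤_) (sym (∙-homo f _ _)) (ℤP.+-mono-≤ px (nonneg-total f pl))

  -- One elimination step, taking the upper bound from a + 1 to a. The condition `b ≤ suc a` ensures
  -- that adding a generator of value a + 1 to one of negative value never falls below 0.
  module Lower (f : Functional) {a b : ℕ} (b≤1+a : b ≤ suc a) (G : List C)
               (bounds : All (Within f b (suc a)) G) where

    merged : List C
    merged = List.filter (Within? f b a) (G List.++ List.cartesianProductWith _∙_ G G)

    -- A `Neg` generator is kept both as an element of `G`, so that it can be paired with a `Top`,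
    -- and as an element of `merged`, so that it can stay if no `Top` is left.
    Top Neg Rest : C → Set
    Top g  = g ∈ G × f ⟨ g ⟩ ≡ + suc a
    Neg g  = g ∈ G × g ∈ merged × (ℤ.- + b) ℤ.≤ f ⟨ g ⟩ × f ⟨ g ⟩ ℤ.< + 0
    Rest g = g ∈ merged × + 0 ℤ.≤ f ⟨ g ⟩

    top-nonneg : ∀ {g} → Top g → + 0 ℤ.≤ f ⟨ g ⟩
    top-nonneg (_ , eq) = subst (+ 0 ℤ.≤_) (sym eq) (ℤ.+≤+ ℕ.z≤n)

    merge-pair : ∀ {g h} → Top g → Neg h → Rest (g ∙ h)
    merge-pair {g} {h} (g∈ , fg) (h∈ , _ , lo , neg) =
      ∈-filter⁺ (Within? f b a) (∈-++⁺ʳ G (∈-cartesianProductWith⁺ _∙_ g∈ h∈))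
        (ℤP.≤-trans ℤP.neg-≤-pos 0≤ , ≤a) , 0≤
      where
      fgh : f ⟨ g ∙ h ⟩ ≡ + suc a ℤ.+ f ⟨ h ⟩
      fgh = trans (∙-homo f g h) (cong (ℤ._+ f ⟨ h ⟩) fg)

      0≤ : + 0 ℤ.≤ f ⟨ g ∙ h ⟩
      0≤ = subst₂ ℤ._≤_ (ℤP.+-inverseʳ (+ suc a)) (sym fgh)
        (ℤP.+-monoʳ-≤ (+ suc a) (ℤP.≤-trans (ℤP.neg-mono-≤ (ℤ.+≤+ b≤1+a)) lo))

      -- An integer below 0 is at most -1, which is what brings a + 1 down to a.
      ≤a : f ⟨ g ∙ h ⟩ ℤ.≤ + a
      ≤a = ℤP.≤-trans (ℤP.≤-reflexive fgh)
        (ℤP.+-monoʳ-≤ (+ suc a) (ℤP.i<j⇒i≤pred[j] neg))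

    -- A generator of the extremal value a + 1 in a sum of value 0 is accompanied by
    -- one of negative value; their sum lies in [0 , a], so it is never merged again.
    merge : ∀ {T N O} → All Top T → All Neg N → All Rest O →
            f ⟨ total T ∙ (total N ∙ total O) ⟩ ≡ + 0 →
            Span merged (total T ∙ (total N ∙ total O))
    merge {N = N} {O} [] pN pO _ =
      N List.++ O ,
      AllP.++⁺ (All.map (λ p → proj₁ (proj₂ p)) pN) (All.map proj₁ pO) ,
      trans (total-++ N O) (sym (CM.identityˡ _))
    merge {g ∷ T} {[]} {O} (pg ∷ pT) [] pO zeroSum = contradiction pos (ℤP.<-irrefl (sym zeroSum))
      where
      pos : + 0 ℤ.< f ⟨ total (g ∷ T) ∙ (ε ∙ total O) ⟩
      pos rewrite CM.identityˡ (total O) | ∙-homo f (g ∙ total T) (total O)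
                | ∙-homo f g (total T) | proj₂ pg =
        ℤP.+-mono-<-≤
          (ℤP.+-mono-<-≤ {+ 0} (ℤ.+<+ ℕ.z<s) (nonneg-total f (All.map top-nonneg pT)))
          (nonneg-total f (All.map proj₂ pO))
    merge {g ∷ T} {h ∷ N} {O} (pg ∷ pT) (ph ∷ pN) pO zeroSum =
      subst (Span merged) regroup
        (merge pT pN (merge-pair pg ph ∷ pO) (trans (cong (f ⟨_⟩) regroup) zeroSum))
      where
      regroup : total T ∙ (total N ∙ ((g ∙ h) ∙ total O)) ≡ (g ∙ total T) ∙ ((h ∙ total N) ∙ total O)
      regroup = solve 5 (λ g t h n o → t ⊕ (n ⊕ ((g ⊕ h) ⊕ o)) ⊜ (g ⊕ t) ⊕ ((h ⊕ n) ⊕ o))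
        refl g (total T) h (total N) (total O)

    classify : ∀ {l} → All (_∈ G) l →
      ∃[ T ] ∃[ N ] ∃[ O ] (All Top T × All Neg N × All Rest O ×
                            total T ∙ (total N ∙ total O) ≡ total l)
    classify [] = [] , [] , [] , [] , [] , [] ,
      trans (CM.identityˡ _) (CM.identityˡ _)
    classify {g ∷ l} (g∈ ∷ l∈)
      with T , N , O , pT , pN , pO , eq ← classify l∈
         | lo , hi ← All.lookup bounds g∈
      with f ⟨ g ⟩ ℤ.≤? + a
    ... | no ≰a = g ∷ T , N , O ,
          (g∈ , ℤP.≤-antisym hi (ℤP.i<j⇒suc[i]≤j (ℤP.≰⇒> ≰a))) ∷ pT , pN , pO ,
          trans (CM.assoc _ _ _) (cong (g ∙_) eq)
    ... | yes ≤a with g∈merged ← ∈-filter⁺ (Within? f b a) (∈-++⁺ˡ g∈) (lo , ≤a)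
                    | + 0 ℤ.≤? f ⟨ g ⟩
    ...   | no ≰f = T , g ∷ N , O , pT , (g∈ , g∈merged , lo , ℤP.≰⇒> ≰f) ∷ pN , pO ,
            trans (solve 4 (λ g t n o → t ⊕ ((g ⊕ n) ⊕ o) ⊜ g ⊕ (t ⊕ (n ⊕ o))) refl
                     g (total T) (total N) (total O))
                  (cong (g ∙_) eq)
    ...   | yes 0≤f = T , N , g ∷ O , pT , pN , (g∈merged , 0≤f) ∷ pO ,
            trans (solve 4 (λ g t n o → t ⊕ (n ⊕ (g ⊕ o)) ⊜ g ⊕ (t ⊕ (n ⊕ o))) refl
                     g (total T) (total N) (total O))
                  (cong (g ∙_) eq)

    merged-spans : ∀ {x} → f ⟨ x ⟩ ≡ + 0 → Span G x → Span merged x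
    merged-spans zeroVal (l , l∈ , refl) with T , N , O , pT , pN , pO , eq ← classify l∈ =
      subst (Span merged) eq (merge pT pN pO (trans (cong (f ⟨_⟩) eq) zeroVal))

    merged-bounds : All (Within f b a) merged
    merged-bounds = AllP.all-filter (Within? f b a) (G List.++ List.cartesianProductWith _∙_ G G)

  -- `P` stands for the equations imposed earlier. New generators are sums of old ones, so closure
  -- under `_∙_` is enough to preserve it.
  module _ (P : C → Set) (P-∙ : ∀ {x y} → P x → P y → P (x ∙ y)) where

    merged-All : ∀ f {a b} (b≤1+a : b ≤ suc a) {G} bounds →
                 All P G → All P (Lower.merged f b≤1+a G bounds)
    merged-All f {a} {b} _ {G} _ pG = AllP.filter⁺ (Within? f b a) (AllP.++⁺ pG
      (AllP.cartesianProductWith⁺ (setoid C) (setoid C) _∙_ G G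
        (λ x∈ y∈ → P-∙ (All.lookup pG x∈) (All.lookup pG y∈))))

    -- Induction on the bound: lowering for `f` takes [-(m+1), m+1] to [-(m+1), m], and lowering for
    -- `negate f` then gives [-m, m]. At bound 0 every generator satisfies the equation itself.
    shrink : ∀ f m G → All P G → All (Within f m m) G →
      ∃[ H ] (All (λ x → P x × f ⟨ x ⟩ ≡ + 0) H × (∀ {x} → f ⟨ x ⟩ ≡ + 0 → Span G x → Span H x))
    shrink f zero G pG wG =
      G , All.zipWith (λ (p , lo , hi) → p , ℤP.≤-antisym hi lo) (pG , wG) , λ _ s → s
    shrink f (suc m) G pG wG =
      let H , pH , H-spans = shrink f m L₂.merged
            (merged-All (negate f) m≤1+m (All.map (Within-negate f) L₁.merged-bounds)
              (merged-All f ℕP.≤-refl wG pG))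
            (All.map (Within-unnegate f) L₂.merged-bounds)
      in H , pH , λ zeroVal s →
           H-spans zeroVal (L₂.merged-spans (cong ℤ.-_ zeroVal) (L₁.merged-spans zeroVal s))
      where
      m≤1+m = ℕP.n≤1+n m
      module L₁ = Lower f {m} {suc m} ℕP.≤-refl G wG
      module L₂ = Lower (negate f) {m} {m} m≤1+m L₁.merged
        (All.map (Within-negate f) L₁.merged-bounds)

    gordan : ∀ f G → All P G →
      ∃[ H ] (All (λ x → P x × f ⟨ x ⟩ ≡ + 0) H × (∀ {x} → f ⟨ x ⟩ ≡ + 0 → Span G x → Span H x))
    gordan f G pG = shrink f (bound G) G pG (within-bound G)
      where
      bound : List C → ℕ
      -- The largest absolute value of `f` on `G` is where the descent of `shrink` starts.
      bound = List.foldr (λ x m → ℤ.∣ f ⟨ x ⟩ ∣ ℕ.⊔ m) 0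

      ∣i∣≤m⇒-m≤i≤m : ∀ i {m} → ℤ.∣ i ∣ ≤ m → (ℤ.- + m) ℤ.≤ i × i ℤ.≤ + m
      ∣i∣≤m⇒-m≤i≤m (+ n)        n≤m = ℤP.neg-≤-pos , ℤ.+≤+ n≤m
      ∣i∣≤m⇒-m≤i≤m ℤ.-[1+ n ] n<m = ℤP.neg-mono-≤ (ℤ.+≤+ n<m) , ℤ.-≤+

      widen : ∀ {m n x} → m ≤ n → Within f m m x → Within f n n x
      widen m≤n (lo , hi) =
        ℤP.≤-trans (ℤP.neg-mono-≤ (ℤ.+≤+ m≤n)) lo , ℤP.≤-trans hi (ℤ.+≤+ m≤n)

      within-bound : ∀ G → All (Within f (bound G) (bound G)) G
      within-bound [] = []
      within-bound (x ∷ G) =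
        ∣i∣≤m⇒-m≤i≤m _ (ℕP.m≤m⊔n _ _) ∷
        All.map (λ {y} → widen {x = y} (ℕP.m≤n⊔m ℤ.∣ f ⟨ x ⟩ ∣ _)) (within-bound G)

-- Minimal Markov bases

telescope : ∀ {n} (x y z : ZVec n) → x -ᵥ z ≡ (x -ᵥ y) +ᵥ (y -ᵥ z)
telescope []      []      []      = refl
telescope (a ∷ x) (b ∷ y) (c ∷ z) = cong₂ _∷_ (lemma a b c) (telescope x y z)
  where
  lemma : ∀ a b c → a ℤ.- c ≡ (a ℤ.- b) ℤ.+ (b ℤ.- c)
  lemma = ℤSolver.solve-∀

x-[x-y]≡y : ∀ {n} (x y : ZVec n) → x -ᵥ (x -ᵥ y) ≡ y
x-[x-y]≡y []      []      = refl
x-[x-y]≡y (a ∷ x) (b ∷ y) = cong₂ _∷_ (lemma a b) (x-[x-y]≡y x y)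
  where
  lemma : ∀ a b → a ℤ.- (a ℤ.- b) ≡ b
  lemma = ℤSolver.solve-∀

x-y≡z+w⇒x-z-y≡w : ∀ {n} (x y z w : ZVec n) → x -ᵥ y ≡ z +ᵥ w → (x -ᵥ z) -ᵥ y ≡ w
x-y≡z+w⇒x-z-y≡w []      []      []      []      _  = refl
x-y≡z+w⇒x-z-y≡w (a ∷ x) (b ∷ y) (c ∷ z) (d ∷ w) eq
  with eq₁ , eq₂ ← VecP.∷-injective eq =
  cong₂ _∷_ (trans (lemma₁ a b c) (trans (cong (ℤ._- c) eq₁) (lemma₂ c d)))
            (x-y≡z+w⇒x-z-y≡w x y z w eq₂)
  where
  lemma₁ : ∀ a b c → (a ℤ.- c) ℤ.- b ≡ (a ℤ.- b) ℤ.- c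
  lemma₁ = ℤSolver.solve-∀
  lemma₂ : ∀ c d → (c ℤ.+ d) ℤ.- c ≡ d
  lemma₂ = ℤSolver.solve-∀

x-x≡0 : ∀ {n} (x : ZVec n) → x -ᵥ x ≡ 0ᵥ
x-x≡0 []      = refl
x-x≡0 (a ∷ x) = cong₂ _∷_ (ℤP.+-inverseʳ a) (x-x≡0 x)

dot-0ᵥ : ∀ {n} (c : ZVec n) → dot c 0ᵥ ≡ + 0
dot-0ᵥ []      = refl
dot-0ᵥ (a ∷ c) = cong₂ ℤ._+_ (ℤP.*-zeroʳ a) (dot-0ᵥ c)

dot-+ᵥ : ∀ {n} (c x y : ZVec n) → dot c (x +ᵥ y) ≡ dot c x ℤ.+ dot c y
dot-+ᵥ []      []      []      = refl
dot-+ᵥ (c ∷ cs) (a ∷ x) (b ∷ y) =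
  trans (cong (λ s → c ℤ.* (a ℤ.+ b) ℤ.+ s) (dot-+ᵥ cs x y)) (lemma c a b (dot cs x) (dot cs y))
  where
  lemma : ∀ c a b p q → c ℤ.* (a ℤ.+ b) ℤ.+ (p ℤ.+ q) ≡ (c ℤ.* a ℤ.+ p) ℤ.+ (c ℤ.* b ℤ.+ q)
  lemma = ℤSolver.solve-∀

dot-negᵥ : ∀ {n} (c x : ZVec n) → dot c (negᵥ x) ≡ ℤ.- dot c x
dot-negᵥ []      []      = refl
dot-negᵥ (c ∷ cs) (a ∷ x) =
  trans (cong (λ s → c ℤ.* (ℤ.- a) ℤ.+ s) (dot-negᵥ cs x)) (lemma c a (dot cs x))
  where
  lemma : ∀ c a p → c ℤ.* (ℤ.- a) ℤ.+ (ℤ.- p) ≡ ℤ.- (c ℤ.* a ℤ.+ p)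
  lemma = ℤSolver.solve-∀

InKer-0ᵥ : ∀ {k n} (M : Matrix k n) → InKer M 0ᵥ
InKer-0ᵥ []      = refl
InKer-0ᵥ (c ∷ M) = cong₂ _∷_ (dot-0ᵥ c) (InKer-0ᵥ M)

InKer-+ᵥ : ∀ {k n} (M : Matrix k n) {x y} → InKer M x → InKer M y → InKer M (x +ᵥ y)
InKer-+ᵥ []      _  _  = refl
InKer-+ᵥ (c ∷ M) {x} {y} kx ky
  with x₁ , x₂ ← VecP.∷-injective kx | y₁ , y₂ ← VecP.∷-injective ky =
  cong₂ _∷_ (trans (dot-+ᵥ c x y) (cong₂ ℤ._+_ x₁ y₁)) (InKer-+ᵥ M x₂ y₂)

InKer-negᵥ⁻ : ∀ {k n} (M : Matrix k n) {x} → InKer M (negᵥ x) → InKer M x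
InKer-negᵥ⁻ []      _  = refl
InKer-negᵥ⁻ (c ∷ M) {x} kx with x₁ , x₂ ← VecP.∷-injective kx =
  cong₂ _∷_ (ℤP.neg-injective (trans (sym (dot-negᵥ c x)) x₁)) (InKer-negᵥ⁻ M x₂)

infixl 6 _⊞_
_⊞_ : ∀ {n} → Vec ℕ n → Vec ℕ n → Vec ℕ n
_⊞_ = Vec.zipWith ℕ._+_

𝟘 : ∀ {n} → Vec ℕ n
𝟘 = Vec.replicate _ 0

diff : ∀ {n} → Vec ℕ n → Vec ℕ n → ZVec n
diff w u = toℤᵥ w -ᵥ toℤᵥ u

diff-⊞ : ∀ {n} (w w′ u u′ : Vec ℕ n) → diff (w ⊞ w′) (u ⊞ u′) ≡ diff w u +ᵥ diff w′ u′
diff-⊞ []      []        []      []        = refl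
diff-⊞ (a ∷ w) (a′ ∷ w′) (b ∷ u) (b′ ∷ u′) =
  cong₂ _∷_ (lemma (+ a) (+ a′) (+ b) (+ b′)) (diff-⊞ w w′ u u′)
  where
  lemma : ∀ a a′ b b′ → (a ℤ.+ a′) ℤ.- (b ℤ.+ b′) ≡ (a ℤ.- b) ℤ.+ (a′ ℤ.- b′)
  lemma = ℤSolver.solve-∀

diff-translate : ∀ {n} (w u c : Vec ℕ n) → diff (w ⊞ c) (u ⊞ c) ≡ diff w u
diff-translate w u c = begin
  diff (w ⊞ c) (u ⊞ c)   ≡⟨ diff-⊞ w c u c ⟩
  diff w u +ᵥ diff c c   ≡⟨ cong (diff w u +ᵥ_) (x-x≡0 (toℤᵥ c)) ⟩
  diff w u +ᵥ 0ᵥ         ≡⟨ VecP.zipWith-identityʳ ℤP.+-identityʳ (diff w u) ⟩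
  diff w u               ∎
  where open ≡-Reasoning

diff≡0⇒≡ : ∀ {n} (w u : Vec ℕ n) → diff w u ≡ 0ᵥ → w ≡ u
diff≡0⇒≡ []      []      _  = refl
diff≡0⇒≡ (a ∷ w) (b ∷ u) eq with eq₁ , eq₂ ← VecP.∷-injective eq =
  cong₂ _∷_ (ℤP.+-injective (ℤP.i-j≡0⇒i≡j (+ a) (+ b) eq₁)) (diff≡0⇒≡ w u eq₂)

Nonneg⇒toℤᵥ : ∀ {n} {x : ZVec n} → Nonneg x → ∃[ y ] toℤᵥ y ≡ x
Nonneg⇒toℤᵥ VAll.[] = [] , refl
Nonneg⇒toℤᵥ {x = + a ∷ _} (_ VAll.∷ px) with y , eq ← Nonneg⇒toℤᵥ px = a ∷ y , cong (+ a ∷_) eq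

toℤᵥ-Nonneg : ∀ {n} (y : Vec ℕ n) → Nonneg (toℤᵥ y)
toℤᵥ-Nonneg []      = VAll.[]
toℤᵥ-Nonneg (_ ∷ y) = ℤ.+≤+ ℕ.z≤n VAll.∷ toℤᵥ-Nonneg y

-- Pairs of vectors with the same image under a matrix

Pair : ℕ → Set
Pair n = Vec ℕ n × Vec ℕ n

_⊞₂_ : ∀ {n} → Pair n → Pair n → Pair n
(w , u) ⊞₂ (w′ , u′) = w ⊞ w′ , u ⊞ u′

pair-isCommutativeMonoid : ∀ n → IsCommutativeMonoid _≡_ (_⊞₂_ {n}) (𝟘 , 𝟘)
pair-isCommutativeMonoid n = record
  { isMonoid = record
    { isSemigroup = record
      { isMagma = record { isEquivalence = isEquivalence ; ∙-cong = cong₂ _⊞₂_ }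
      ; assoc = λ (a , b) (c , d) (e , f) → cong₂ _,_ (assoc a c e) (assoc b d f)
      }
    ; identity = (λ (a , b) → cong₂ _,_ (identityˡ a) (identityˡ b))
               , (λ (a , b) → cong₂ _,_ (identityʳ a) (identityʳ b))
    }
  ; comm = λ (a , b) (c , d) → cong₂ _,_ (comm a c) (comm b d)
  }
  where
  assoc : ∀ x y z → (x ⊞ y) ⊞ z ≡ x ⊞ (y ⊞ z)
  assoc = VecP.zipWith-assoc {n = n} ℕP.+-assoc
  identityˡ : ∀ x → 𝟘 ⊞ x ≡ x
  identityˡ = VecP.zipWith-identityˡ {n = n} ℕP.+-identityˡ
  identityʳ : ∀ x → x ⊞ 𝟘 ≡ x
  identityʳ = VecP.zipWith-identityʳ {n = n} ℕP.+-identityʳ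
  comm : ∀ x y → x ⊞ y ≡ y ⊞ x
  comm = VecP.zipWith-comm {n = n} ℕP.+-comm

open module Pairs {n} = Gordan (pair-isCommutativeMonoid n)

prefix : ∀ {n} → ℕ → ℕ → Pair n → Pair (suc n)
prefix x y (w , u) = x ∷ w , y ∷ u

prefix-⊞₂ : ∀ {n} x x′ y y′ (p : Pair n) →
            prefix x y (𝟘 , 𝟘) ⊞₂ prefix x′ y′ p ≡ prefix (x ℕ.+ x′) (y ℕ.+ y′) p
prefix-⊞₂ x x′ y y′ (w , u) = cong₂ _,_
  (cong (x ℕ.+ x′ ∷_) (VecP.zipWith-identityˡ ℕP.+-identityˡ w))
  (cong (y ℕ.+ y′ ∷_) (VecP.zipWith-identityˡ ℕP.+-identityˡ u))

units : ∀ n → List (Pair n)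
units zero    = []
units (suc n) = prefix 1 0 (𝟘 , 𝟘) ∷ prefix 0 1 (𝟘 , 𝟘) ∷ List.map (prefix 0 0) (units n)

units-span : ∀ {n} (p : Pair n) → Span (units n) p
units-span {zero}  ([] , [])       = [] , [] , refl
units-span {suc n} (x ∷ w , y ∷ u) =
  subst (Span (units (suc n)))
    (trans (cong (prefix x 0 (𝟘 , 𝟘) ⊞₂_) (prefix-⊞₂ 0 0 y 0 (w , u)))
      (trans (prefix-⊞₂ x 0 0 (y ℕ.+ 0) (w , u))
        (cong₂ (λ i j → prefix i j (w , u)) (ℕP.+-identityʳ x) (ℕP.+-identityʳ y))))
    (Span-∙ (multiplesˡ x) (Span-∙ (multiplesʳ y) (lifted (units-span (w , u)))))
  where
  multiplesˡ : ∀ x → Span (units (suc n)) (prefix x 0 (𝟘 , 𝟘))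
  multiplesˡ zero    = [] , [] , refl
  multiplesˡ (suc x) with l , l∈ , eq ← multiplesˡ x =
    _ ∷ l , here refl ∷ l∈ , trans (cong (prefix 1 0 (𝟘 , 𝟘) ⊞₂_) eq) (prefix-⊞₂ 1 x 0 0 (𝟘 , 𝟘))

  multiplesʳ : ∀ y → Span (units (suc n)) (prefix 0 y (𝟘 , 𝟘))
  multiplesʳ zero    = [] , [] , refl
  multiplesʳ (suc y) with l , l∈ , eq ← multiplesʳ y =
    _ ∷ l , there (here refl) ∷ l∈ , trans (cong (prefix 0 1 (𝟘 , 𝟘) ⊞₂_) eq) (prefix-⊞₂ 0 0 1 y (𝟘 , 𝟘))

  lifted : ∀ {p} → Span (units n) p → Span (units (suc n)) (prefix 0 0 p)
  lifted ([] , [] , refl) = [] , [] , refl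
  lifted (g ∷ l , g∈ ∷ l∈ , refl) with m , m∈ , eq ← lifted (l , l∈ , refl) =
    prefix 0 0 g ∷ m , there (there (∈-map⁺ (prefix 0 0) g∈)) ∷ m∈ , cong (prefix 0 0 g ⊞₂_) eq

SameImage : ∀ {k n} → Matrix k n → Pair n → Set
SameImage M (w , u) = InKer M (diff w u)

SameImage-⊞₂ : ∀ {k n} (M : Matrix k n) {p q} → SameImage M p → SameImage M q → SameImage M (p ⊞₂ q)
SameImage-⊞₂ M {w , u} {w′ , u′} kp kq =
  subst (InKer M) (sym (diff-⊞ w w′ u u′)) (InKer-+ᵥ M kp kq)

rowFunctional : ∀ {n} → ZVec n → Functional {n}
rowFunctional c = record
  { _⟨_⟩ = λ (w , u) → dot c (diff w u)
  ; ε-homo = trans (cong (dot c) (x-x≡0 (toℤᵥ 𝟘))) (dot-0ᵥ c)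
  ; ∙-homo = λ (w , u) (w′ , u′) →
      trans (cong (dot c) (diff-⊞ w w′ u u′)) (dot-+ᵥ c (diff w u) (diff w′ u′))
  }

-- Row by row: the unit pairs generate all pairs, and each further row is one more linear equation,
-- imposed by `gordan` on the generators found for the remaining rows.
kernel-generators : ∀ {k n} (M : Matrix k n) →
  ∃[ H ] (All (SameImage M) H × (∀ {p} → SameImage M p → Span H p))
kernel-generators {n = n} [] = units n , All.tabulate (λ _ → refl) , λ _ → units-span _
kernel-generators (c ∷ M) =
  let G , pG , G-spans = kernel-generators M
      H , pH , H-spans = gordan (SameImage M) (λ {p} {q} → SameImage-⊞₂ M {p} {q})
                                (rowFunctional c) G pG
  in H , All.map (λ (k , c0) → cong₂ _∷_ c0 k) pH ,
     λ k → let c0 , k′ = VecP.∷-injective k in H-spans c0 (G-spans k′)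

-- Decidability of reachability

module Reachability {A : Set} (R : A → A → Set) (_≟_ : DecidableEquality A) (R? : Decidable R) where

  -- As in the Floyd–Warshall algorithm: paths whose intermediate vertices lie in the list.
  Via : List A → A → A → Set
  Via []      x y = x ≡ y ⊎ R x y
  Via (v ∷ V) x y = Via V x y ⊎ (Via V x v × Via V v y)

  Via? : ∀ V → Decidable (Via V)
  Via? []      x y = (x ≟ y) ⊎-dec R? x y
  Via? (v ∷ V) x y = Via? V x y ⊎-dec (Via? V x v ×-dec Via? V v y)

  Via⇒Star : ∀ V {x y} → Via V x y → Star R x y
  Via⇒Star []      (inj₁ refl)    = ε
  Via⇒Star []      (inj₂ r)       = r ◅ ε
  Via⇒Star (v ∷ V) (inj₁ p)       = Via⇒Star V p
  Via⇒Star (v ∷ V) (inj₂ (p , q)) = Via⇒Star V p ◅◅ Via⇒Star V q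

  base : ∀ V {x y} → x ≡ y ⊎ R x y → Via V x y
  base []      b = b
  base (v ∷ V) b = inj₁ (base V b)

  -- Induction on the position of `v`. If `v` is the head, returns to it are cut off by `ending` and
  -- `starting`. If both paths pass through an earlier head, the detour from that head to `v` and
  -- back is dropped.
  Via-trans : ∀ {V x v y} → v ∈ V → Via V x v → Via V v y → Via V x y
  Via-trans (here refl) p q = inj₂ (ending p , starting q)
    where
    ending : ∀ {V x v} → Via (v ∷ V) x v → Via V x v
    ending (inj₁ p)       = p
    ending (inj₂ (p , _)) = p
    starting : ∀ {V v y} → Via (v ∷ V) v y → Via V v y
    starting (inj₁ q)       = q
    starting (inj₂ (_ , q)) = q
  Via-trans (there v∈) (inj₁ p)        (inj₁ q)        = inj₁ (Via-trans v∈ p q)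
  Via-trans (there v∈) (inj₁ p)        (inj₂ (q , q′)) = inj₂ (Via-trans v∈ p q , q′)
  Via-trans (there v∈) (inj₂ (p , p′)) (inj₁ q)        = inj₂ (p , Via-trans v∈ p′ q)
  Via-trans (there v∈) (inj₂ (p , _))  (inj₂ (_ , q′)) = inj₂ (p , q′)

  -- The list has to contain only what is reachable from the starting point, so the vertex type may
  -- be infinite, as `Vec ℕ n` is.
  Star⇒Via : ∀ V {x y} → (∀ {z} → Star R x z → z ∈ V) → Star R x y → Via V x y
  Star⇒Via V closed ε        = base V (inj₁ refl)
  Star⇒Via V closed (r ◅ rs) =
    Via-trans (closed (r ◅ ε)) (base V (inj₂ r)) (Star⇒Via V (closed ∘ (r ◅_)) rs)

  Star? : ∀ V {x} y → (∀ {z} → Star R x z → z ∈ V) → Dec (Star R x y)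
  Star? V y closed = map′ (Via⇒Star V) (Star⇒Via V closed) (Via? V _ y)

-- Bounds each coordinate by s instead of the sum: a finite list that contains the fibre suffices
-- for the search.
box : ∀ n → ℕ → List (Vec ℕ n)
box zero    s = [] ∷ []
box (suc n) s = List.cartesianProductWith _∷_ (List.upTo (suc s)) (box n s)

∈-box : ∀ {n} (w : Vec ℕ n) {s} → Vec.sum w ≤ s → w ∈ box n s
∈-box []      _ = here refl
∈-box (a ∷ w) a+w≤s = ∈-cartesianProductWith⁺ _∷_
  (∈-upTo⁺ (ℕ.s≤s (ℕP.≤-trans (ℕP.m≤m+n a _) a+w≤s)))
  (∈-box w (ℕP.≤-trans (ℕP.m≤n+m _ a) a+w≤s))

-- Markov moves as steps between natural vectors

_∈±_ : ∀ {n} → ZVec n → List (ZVec n) → Set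
v ∈± S = v ∈ S ⊎ negᵥ v ∈ S

_≟ᵥ_ : ∀ {n} → DecidableEquality (ZVec n)
_≟ᵥ_ = VecP.≡-dec ℤ._≟_

_∈±?_ : ∀ {n} (v : ZVec n) S → Dec (v ∈± S)
v ∈±? S = any? (v ≟ᵥ_) S ⊎-dec any? (negᵥ v ≟ᵥ_) S

-- With natural vectors as vertices, the nonnegativity of intermediate points is part of the type,
-- and a move is recovered as the difference of its endpoints.
Step : ∀ {n} → List (ZVec n) → Vec ℕ n → Vec ℕ n → Set
Step S x y = diff x y ∈± S

Connected : ∀ {n} → List (ZVec n) → Vec ℕ n → Vec ℕ n → Set
Connected S = Star (Step S)

-- Each `Nonneg` witness in `StaysNonneg` turns the next partial difference into a natural vector,
-- the next vertex of the path.
walk⇒Connected : ∀ {n} {S : List (ZVec n)} x u vs → All (_∈± S) vs → StaysNonneg (toℤᵥ x) vs →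
                 diff x u ≡ sumᵥ vs → Connected S x u
walk⇒Connected x u [] [] _ eq with refl ← diff≡0⇒≡ x u eq = ε
walk⇒Connected {S = S} x u (v ∷ vs) (v∈ ∷ vs∈) (nn , stays) eq
  with y , y≡x-v ← Nonneg⇒toℤᵥ nn =
  subst (_∈± S) (sym (trans (cong (toℤᵥ x -ᵥ_) y≡x-v) (x-[x-y]≡y (toℤᵥ x) v))) v∈ ◅
  walk⇒Connected y u vs vs∈ (subst (λ z → StaysNonneg z vs) (sym y≡x-v) stays)
    (trans (cong (_-ᵥ toℤᵥ u) y≡x-v) (x-y≡z+w⇒x-z-y≡w (toℤᵥ x) (toℤᵥ u) v (sumᵥ vs) eq))

Connected⇒walk : ∀ {n} {S : List (ZVec n)} {x u} → Connected S x u →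
  ∃[ vs ] (All (_∈± S) vs × StaysNonneg (toℤᵥ x) vs × diff x u ≡ sumᵥ vs)
Connected⇒walk {x = x} ε = [] , [] , tt , x-x≡0 (toℤᵥ x)
Connected⇒walk {x = x} {u} (_◅_ {j = y} s ss) with vs , vs∈ , stays , eq ← Connected⇒walk ss =
  diff x y ∷ vs , s ∷ vs∈ ,
  (subst Nonneg (sym x-v≡y) (toℤᵥ-Nonneg y) , subst (λ z → StaysNonneg z vs) (sym x-v≡y) stays) ,
  trans (telescope (toℤᵥ x) (toℤᵥ y) (toℤᵥ u)) (cong (diff x y +ᵥ_) eq)
  where
  x-v≡y = x-[x-y]≡y (toℤᵥ x) (toℤᵥ y)

Connected-translate : ∀ {n} {S : List (ZVec n)} c {x u} → Connected S x u → Connected S (x ⊞ c) (u ⊞ c)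
Connected-translate {S = S} c = gmap (_⊞ c) λ {x} {y} → subst (_∈± S) (sym (diff-translate x y c))

Connected-mono : ∀ {n} {S T : List (ZVec n)} → (∀ {v} → v ∈ S → v ∈ T) →
                 ∀ {x u} → Connected S x u → Connected T x u
Connected-mono S⊆T = gmap id (Sum.map S⊆T S⊆T)

-- Indispensable moves and existence of a minimal Markov basis

module _ {k n} (M : Matrix k n) where

  markov⇒Connected : ∀ {S w u} → IsMarkovBasis M S → InKer M (diff w u) → Connected S w u
  markov⇒Connected {w = w} {u} (_ , connect) k with vs , vs∈ , stays , eq ← connect w u k =
    walk⇒Connected w u vs vs∈ stays eq

  Connected⇒markov : ∀ {S} → All (InKer M) S → (∀ {w u} → InKer M (diff w u) → Connected S w u) →
                     IsMarkovBasis M S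
  Connected⇒markov S⊆ker connected = S⊆ker , λ w u k → Connected⇒walk (connected k)

  Step-InKer : ∀ {S x y} → All (InKer M) S → Step S x y → InKer M (diff x y)
  Step-InKer S⊆ker (inj₁ v∈)  = All.lookup S⊆ker v∈
  Step-InKer S⊆ker (inj₂ -v∈) = InKer-negᵥ⁻ M (All.lookup S⊆ker -v∈)

  Connected-InKer : ∀ {S x y} → All (InKer M) S → Connected S x y → InKer M (diff x y)
  Connected-InKer {x = x} _ ε = subst (InKer M) (sym (x-x≡0 (toℤᵥ x))) (InKer-0ᵥ M)
  Connected-InKer {x = x} {z} S⊆ker (_◅_ {j = y} s ss) =
    subst (InKer M) (sym (telescope (toℤᵥ x) (toℤᵥ y) (toℤᵥ z)))
      (InKer-+ᵥ M (Step-InKer {x = x} S⊆ker s) (Connected-InKer S⊆ker ss))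

  -- A path from `w` to `u` stays in the fibre {w, u}. Its steps remain at `w` until one leads to
  -- `u`, and the move of that step is `diff w u` up to sign.
  indispensable : ∀ {S} w u → IsMarkovBasis M S → InKer M (diff w u) → w ≢ u →
                  (∀ z → InKer M (diff w z) → z ≡ w ⊎ z ≡ u) → diff w u ∈± S
  indispensable {S} w u markov k w≢u fibre = go (markov⇒Connected markov k)
    where
    go : Connected S w u → diff w u ∈± S
    go ε = contradiction refl w≢u
    go (_◅_ {j = z} s ss) with fibre z (Step-InKer {x = w} (proj₁ markov) s)
    ... | inj₁ refl = go ss
    ... | inj₂ refl = s

  -- The grading makes fibres finite: all points of a fibre have the same coordinate sum.
  module Minimal (graded : ∀ w u → InKer M (diff w u) → Vec.sum w ≡ Vec.sum u) where

    private
      H = proj₁ (kernel-generators M)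
      H-kernel = proj₁ (proj₂ (kernel-generators M))
      H-spans = proj₂ (proj₂ (kernel-generators M))

    Generated : List (ZVec n) → Set
    Generated S = All (λ (p , q) → Connected S p q) H

    -- A pair with equal images is a sum of generators (p , q), and the summands p are exchanged for
    -- q one at a time.
    Generated⇒markov : ∀ {S} → All (InKer M) S → Generated S → IsMarkovBasis M S
    Generated⇒markov {S} S⊆ker gen = Connected⇒markov S⊆ker (λ k → connect (H-spans k))
      where
      connect : ∀ {w u} → Span H (w , u) → Connected S w u
      connect ([] , [] , refl) = ε
      connect ((p , q) ∷ l , g∈ ∷ l∈ , refl) =
        -- The path runs p + w, then q + w, then q + u. Translation adds on the right, whence the
        -- commutations.
        Connected-translate _ (All.lookup gen g∈) ◅◅
        subst₂ (Connected S) (VecP.zipWith-comm ℕP.+-comm w q) (VecP.zipWith-comm ℕP.+-comm u q)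
          (Connected-translate q (connect (l , l∈ , refl)))
        where
        w = proj₁ (total l)
        u = proj₂ (total l)

    markov⇒Generated : ∀ {S} → IsMarkovBasis M S → Generated S
    markov⇒Generated markov = All.map (markov⇒Connected markov) H-kernel

    markov? : ∀ {S} → All (InKer M) S → Dec (IsMarkovBasis M S)
    markov? {S} S⊆ker =
      map′ (Generated⇒markov S⊆ker) markov⇒Generated (All.all? (λ (p , q) → connected? p q) H)
      where
      connected? : ∀ p q → Dec (Connected S p q)
      -- Whatever is connected to `p` lies in its fibre, hence in the box given by the coordinate
      -- sum of `p`.
      connected? p q = Reachability.Star? (Step S) (VecP.≡-dec ℕ._≟_) (λ x y → diff x y ∈±? S)
        (box n (Vec.sum p)) q
        λ {z} c → ∈-box z (ℕP.≤-reflexive (sym (graded p z (Connected-InKer S⊆ker c))))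

    initial : ∃[ S ] IsMarkovBasis M S
    initial = S , Generated⇒markov (AllP.map⁺ H-kernel)
      (All.tabulate λ h∈ → inj₁ (∈-map⁺ (λ (p , q) → diff p q) h∈) ◅ ε)
      where S = List.map (λ (p , q) → diff p q) H

    _≢?_ : Decidable {A = ZVec n} _≢_
    x ≢? y = ¬? (x ≟ᵥ y)

    -- Filtering removes every copy of `x`, so the length drops. Testing single deletions is enough
    -- for minimality: a Markov basis inside `S` that misses `x` is contained in `S` without `x`,
    -- and enlarging a Markov basis by kernel vectors keeps it one.
    minimise : ∀ S → Acc ℕ._<_ (List.length S) → IsMarkovBasis M S → ∃[ 𝓜 ] IsMinimalMarkovBasis M 𝓜
    minimise S (acc rec) markov
      with any? (λ x → markov? (AllP.filter⁺ (x ≢?_) (proj₁ markov))) S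
    ... | yes removable with x , x∈ , markov′ ← find removable =
          minimise (List.filter (x ≢?_) S)
            (rec (ListP.filter-notAll (x ≢?_) S (Any.map (λ x≡y x≢y → x≢y x≡y) x∈))) markov′
    ... | no irremovable = S , markov , λ 𝓢 𝓢⊆S (x , x∈S , x∉𝓢) markov𝓢 →
          irremovable (lose x∈S (Connected⇒markov (AllP.filter⁺ (x ≢?_) (proj₁ markov)) λ k →
            Connected-mono
              (λ v∈𝓢 → ∈-filter⁺ (x ≢?_) (All.lookup 𝓢⊆S v∈𝓢) λ { refl → x∉𝓢 v∈𝓢 })
              (markov⇒Connected markov𝓢 k)))

    minimal-exists : ∃[ 𝓜 ] IsMinimalMarkovBasis M 𝓜
    minimal-exists = minimise (proj₁ initial) (<-wellFounded _) (proj₂ initial)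

    indispensable-universal : ∀ w u → InKer M (diff w u) → w ≢ u →
      (∀ z → InKer M (diff w z) → z ≡ w ⊎ z ≡ u) → InUniversalMarkovBasis M (diff w u)
    indispensable-universal w u k w≢u fibre with 𝓜 , minimal ← minimal-exists =
      𝓜 , minimal , indispensable w u (proj₁ minimal) k w≢u fibre

-- Lawrence liftings

dot-++ : ∀ {m n} (a c : ZVec m) (b d : ZVec n) → dot (a ++ b) (c ++ d) ≡ dot a c ℤ.+ dot b d
dot-++ []      []      b d = sym (ℤP.+-identityˡ _)
dot-++ (x ∷ a) (y ∷ c) b d = trans (cong (λ s → x ℤ.* y ℤ.+ s) (dot-++ a c b d)) (sym (ℤP.+-assoc (x ℤ.* y) _ _))

dot-0ᵥˡ : ∀ {n} (x : ZVec n) → dot 0ᵥ x ≡ + 0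
dot-0ᵥˡ []      = refl
dot-0ᵥˡ (_ ∷ x) = trans (ℤP.+-identityˡ _) (dot-0ᵥˡ x)

dot-unitᵥ : ∀ {n} (j : Fin n) (x : ZVec n) → dot (unitᵥ j) x ≡ lookup x j
dot-unitᵥ zero    (a ∷ x) = trans (cong₂ ℤ._+_ (ℤP.*-identityˡ a) (zeros x)) (ℤP.+-identityʳ a)
  where
  zeros : ∀ {n} (x : ZVec n) → dot (tabulate (λ _ → + 0)) x ≡ + 0
  zeros []      = refl
  zeros (_ ∷ x) = trans (ℤP.+-identityˡ _) (zeros x)
dot-unitᵥ (suc j) (_ ∷ x) = trans (ℤP.+-identityˡ _) (dot-unitᵥ j x)

InKer⇒All : ∀ {k n} (M : Matrix k n) {v} → InKer M v → VAll.All (λ c → dot c v ≡ + 0) M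
InKer⇒All []      _ = []
InKer⇒All (c ∷ M) k = proj₁ (VecP.∷-injective k) ∷ InKer⇒All M (proj₂ (VecP.∷-injective k))

All⇒InKer : ∀ {k n} {M : Matrix k n} {v} → VAll.All (λ c → dot c v ≡ + 0) M → InKer M v
All⇒InKer []       = refl
All⇒InKer (p ∷ ps) = cong₂ _∷_ p (All⇒InKer ps)

columnSums : ∀ {r n} → Vec (ZVec n) r → ZVec n
columnSums []       = 0ᵥ
columnSums (b ∷ bs) = b +ᵥ columnSums bs

-- Repeats the expression inside `lawrence`, so that the diagonal rows of the lifting unfold to it.
blockRow : ∀ {r n} → ZVec n → Fin r → ZVec (r ℕ.* n)
blockRow {r} c k = concat (tabulate λ (l : Fin r) → if does (k Fin.≟ l) then c else replicate _ (+ 0))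

dot-blockRow : ∀ {r n} (c : ZVec n) (k : Fin r) (bs : Vec (ZVec n) r) →
               dot (blockRow c k) (concat bs) ≡ dot c (lookup bs k)
dot-blockRow {suc r} {n} c zero (b ∷ bs) =
  trans (dot-++ c b (concat (tabulate {n = r} λ _ → 0ᵥ {n})) (concat bs))
    (trans (cong (λ s → dot c b ℤ.+ s) (zeros bs)) (ℤP.+-identityʳ _))
  where
  zeros : ∀ {r n} (bs : Vec (ZVec n) r) → dot (concat (tabulate {n = r} λ _ → 0ᵥ {n})) (concat bs) ≡ + 0
  zeros []       = refl
  zeros {suc r} (b ∷ bs) =
    trans (dot-++ 0ᵥ b (concat (tabulate {n = r} λ _ → 0ᵥ)) (concat bs))
      (cong₂ ℤ._+_ (dot-0ᵥˡ b) (zeros bs))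
dot-blockRow c (suc k) (b ∷ bs) =
  trans (dot-++ 0ᵥ b (blockRow c k) (concat bs))
    (trans (cong₂ ℤ._+_ (dot-0ᵥˡ b) (dot-blockRow c k bs)) (ℤP.+-identityˡ _))

dot-unitRow : ∀ {r n} (j : Fin n) (bs : Vec (ZVec n) r) →
              dot (concat (replicate r (unitᵥ j))) (concat bs) ≡ lookup (columnSums bs) j
dot-unitRow j []       = sym (VecP.lookup-replicate j (+ 0))
dot-unitRow j (b ∷ bs) =
  trans (dot-++ (unitᵥ j) b _ (concat bs))
    (trans (cong₂ ℤ._+_ (dot-unitᵥ j b) (dot-unitRow j bs))
      (sym (VecP.lookup-zipWith ℤ._+_ j b (columnSums bs))))

module _ {m n} (r : ℕ) (A : Matrix m n) (bs : Vec (ZVec n) r) where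

  -- The diagonal rows apply `A` to one block each, and the final rows read off the column sums; the
  -- proof follows this order of rows.
  lawrence-InKer⁺ : VAll.All (InKer A) bs → columnSums bs ≡ 0ᵥ → InKer (lawrence r A) (concat bs)
  lawrence-InKer⁺ kers sum0 = All⇒InKer (VAllP.++⁺
    (VAllP.concat⁺ (VAllP.tabulate⁺ λ k → VAllP.map⁺
      (VAll.map (λ {c} p → trans (dot-blockRow c k bs) p) (InKer⇒All A (VAllP.lookup⁺ kers k)))))
    (VAllP.tabulate⁺ λ j → trans (dot-unitRow j bs)
      (trans (cong (λ x → lookup x j) sum0) (VecP.lookup-replicate j (+ 0)))))

  lawrence-InKer⁻ : InKer (lawrence r A) (concat bs) → VAll.All (InKer A) bs × columnSums bs ≡ 0ᵥ
  lawrence-InKer⁻ k with diag , ids ← VAllP.++⁻ _ (InKer⇒All (lawrence r A) k) =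
    VAllP.lookup⁻ (λ l → All⇒InKer (VAll.map (λ {c} p → trans (sym (dot-blockRow c l bs)) p)
      (VAllP.map⁻ (VAllP.tabulate⁻ (VAllP.concat⁻ _ diag) l)))) ,
    vanishing (VAllP.lookup⁻ (λ j → trans (sym (dot-unitRow j bs)) (VAllP.tabulate⁻ ids j)))
    where
    vanishing : ∀ {n} {x : ZVec n} → VAll.All (_≡ + 0) x → x ≡ 0ᵥ
    vanishing []       = refl
    vanishing (p ∷ ps) = cong₂ _∷_ p (vanishing ps)

blocks-concat : ∀ {r n} (bs : Vec (ZVec n) r) → blocks r (concat bs) ≡ bs
blocks-concat []       = refl
blocks-concat {suc r} {n} (b ∷ bs)
  with take≡ , drop≡ ← VecP.++-injective (Vec.take n (b ++ concat bs)) b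
                         (VecP.take++drop≡id n (b ++ concat bs)) =
  cong₂ _∷_ take≡ (trans (cong (blocks r) drop≡) (blocks-concat bs))

count-all : ∀ {A : Set} {P : A → Set} (P? : Unary.Decidable P) {n} {xs : Vec A n} →
            VAll.All P xs → Vec.count P? xs ≡ n
count-all P? []       = refl
count-all P? {xs = x ∷ _} (p ∷ ps) with P? x
... | yes _ = cong suc (count-all P? ps)
... | no ¬p = contradiction p ¬p

rowTotal : ∀ {r n} → Vec (Vec ℕ n) r → Vec ℕ n
rowTotal []       = 𝟘
rowTotal (w ∷ ws) = w ⊞ rowTotal ws

diff-++ : ∀ {m n} (w u : Vec ℕ m) (w′ u′ : Vec ℕ n) → diff (w ++ w′) (u ++ u′) ≡ diff w u ++ diff w′ u′
diff-++ []      []      w′ u′ = refl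
diff-++ (a ∷ w) (b ∷ u) w′ u′ = cong (_ ∷_) (diff-++ w u w′ u′)

diff-concat : ∀ {r n} (ws us : Vec (Vec ℕ n) r) → diff (concat ws) (concat us) ≡ concat (zipWith diff ws us)
diff-concat []       []       = refl
diff-concat (w ∷ ws) (u ∷ us) =
  trans (diff-++ w u (concat ws) (concat us)) (cong (diff w u ++_) (diff-concat ws us))

type-full : ∀ {r n} (ws us : Vec (Vec ℕ n) r) → VAll.All (_≢ 0ᵥ) (zipWith diff ws us) →
            type r (diff (concat ws) (concat us)) ≡ r
type-full ws us nonzero rewrite diff-concat ws us | blocks-concat (zipWith diff ws us) =
  count-all (λ row → ¬? (row ≟ᵥ 0ᵥ)) nonzero

columnSums-diff : ∀ {r n} (ws us : Vec (Vec ℕ n) r) →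
                  columnSums (zipWith diff ws us) ≡ diff (rowTotal ws) (rowTotal us)
columnSums-diff []       []       = sym (x-x≡0 (toℤᵥ 𝟘))
columnSums-diff (w ∷ ws) (u ∷ us) =
  trans (cong (diff w u +ᵥ_) (columnSums-diff ws us)) (sym (diff-⊞ w (rowTotal ws) u (rowTotal us)))

-- Kernel membership for the lifting in matrix form, with column totals compared in ℕ so that no
-- subtraction enters.
SameFibre : ∀ {m n r} → Matrix m n → Vec (Vec ℕ n) r → Vec (Vec ℕ n) r → Set
SameFibre A ws us = VAll.All (InKer A) (zipWith diff ws us) × rowTotal ws ≡ rowTotal us

module _ {m n r} (A : Matrix m n) (ws us : Vec (Vec ℕ n) r) where

  sameFibre⁺ : SameFibre A ws us → InKer (lawrence r A) (diff (concat ws) (concat us))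
  sameFibre⁺ (kers , totals) = subst (InKer (lawrence r A)) (sym (diff-concat ws us))
    (lawrence-InKer⁺ r A _ kers
      (trans (columnSums-diff ws us)
        (trans (cong (diff (rowTotal ws)) (sym totals)) (x-x≡0 (toℤᵥ (rowTotal ws))))))

  sameFibre⁻ : InKer (lawrence r A) (diff (concat ws) (concat us)) → SameFibre A ws us
  sameFibre⁻ k with kers , sums ← lawrence-InKer⁻ r A _ (subst (InKer (lawrence r A)) (diff-concat ws us) k) =
    kers , diff≡0⇒≡ _ _ (trans (sym (columnSums-diff ws us)) sums)

sum-⊞ : ∀ {n} (w u : Vec ℕ n) → Vec.sum (w ⊞ u) ≡ Vec.sum w ℕ.+ Vec.sum u
sum-⊞ []      []      = refl
sum-⊞ (a ∷ w) (b ∷ u) = trans (cong (λ s → a ℕ.+ b ℕ.+ s) (sum-⊞ w u)) (lemma a b (Vec.sum w) (Vec.sum u))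
  where
  lemma : ∀ a b x y → a ℕ.+ b ℕ.+ (x ℕ.+ y) ≡ (a ℕ.+ x) ℕ.+ (b ℕ.+ y)
  lemma = ℕSolver.solve-∀

sum-𝟘 : ∀ n → Vec.sum (𝟘 {n}) ≡ 0
sum-𝟘 zero    = refl
sum-𝟘 (suc n) = sum-𝟘 n

sum-concat : ∀ {r n} (ws : Vec (Vec ℕ n) r) → Vec.sum (concat ws) ≡ Vec.sum (rowTotal ws)
sum-concat {n = n} []       = sym (sum-𝟘 n)
sum-concat         (w ∷ ws) = trans (VecP.sum-++ w)
  (trans (cong (Vec.sum w ℕ.+_) (sum-concat ws)) (sym (sum-⊞ w (rowTotal ws))))

-- The final block row fixes every column total and therefore the sum of all entries, whatever `A`
-- is.
lawrence-graded : ∀ {m n} r (A : Matrix m n) w u → InKer (lawrence r A) (diff w u) → Vec.sum w ≡ Vec.sum u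
lawrence-graded {n = n} r A w u k
  with ws , refl ← Vec.group r n w | us , refl ← Vec.group r n u =
  trans (sum-concat ws) (trans (cong Vec.sum (proj₂ (sameFibre⁻ A ws us k))) (sym (sum-concat us)))

-- Kernel equations for nonnegative rows as equations in ℕ

ndot : ∀ {n} → Vec ℕ n → Vec ℕ n → ℕ
ndot c w = Vec.sum (zipWith ℕ._*_ c w)

dot-diff : ∀ {n} (c w u : Vec ℕ n) → dot (toℤᵥ c) (diff w u) ≡ + ndot c w ℤ.- + ndot c u
dot-diff []      []      []      = refl
dot-diff (c ∷ cs) (a ∷ w) (b ∷ u) =
  trans (cong (λ s → + c ℤ.* (+ a ℤ.- + b) ℤ.+ s) (dot-diff cs w u))
    (trans (lemma (+ c) (+ a) (+ b) (+ ndot cs w) (+ ndot cs u))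
      (cong₂ ℤ._-_ (eval a (ndot cs w)) (eval b (ndot cs u))))
  where
  lemma : ∀ c a b x y → c ℤ.* (a ℤ.- b) ℤ.+ (x ℤ.- y) ≡ (c ℤ.* a ℤ.+ x) ℤ.- (c ℤ.* b ℤ.+ y)
  lemma = ℤSolver.solve-∀
  eval : ∀ a x → + c ℤ.* + a ℤ.+ + x ≡ + (c ℕ.* a ℕ.+ x)
  eval a x = cong (ℤ._+ + x) (sym (ℤP.pos-* c a))

ndot≡⇒dot≡0 : ∀ {n} (c w u : Vec ℕ n) → ndot c w ≡ ndot c u → dot (toℤᵥ c) (diff w u) ≡ + 0
ndot≡⇒dot≡0 c w u eq = trans (dot-diff c w u) (ℤP.i≡j⇒i-j≡0 (cong +_ eq))

dot≡0⇒ndot≡ : ∀ {n} (c w u : Vec ℕ n) → dot (toℤᵥ c) (diff w u) ≡ + 0 → ndot c w ≡ ndot c u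
dot≡0⇒ndot≡ c w u eq = ℤP.+-injective (ℤP.i-j≡0⇒i≡j _ _ (trans (sym (dot-diff c w u)) eq))

-- The monomial curves with exponents 0, 1, k+1, k+2

ones : Vec ℕ 4
ones = 1 ∷ 1 ∷ 1 ∷ 1 ∷ []

exponents : ℕ → Vec ℕ 4
exponents k = 0 ∷ 1 ∷ suc k ∷ suc (suc k) ∷ []

curve : ℕ → Matrix 2 4
curve k = toℤᵥ ones ∷ toℤᵥ (exponents k) ∷ []

-- Two-point fibres and the move of type k + 2

module Witness (k : ℕ) (k≢0 : k ≢ 0) where

  open import Data.Nat using (_+_; _*_)

  p⁺ p⁻ s⁺ s⁻ t⁺ t⁻ : Vec ℕ 4
  p⁺ = 1 ∷ 0 ∷ 0 ∷ 1 ∷ []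
  p⁻ = 0 ∷ 1 ∷ 1 ∷ 0 ∷ []
  s⁺ = 0 ∷ suc k ∷ 0 ∷ 0 ∷ []
  s⁻ = k ∷ 0 ∷ 1 ∷ 0 ∷ []
  t⁺ = 0 ∷ 0 ∷ suc k ∷ 0 ∷ []
  t⁻ = 0 ∷ 1 ∷ 0 ∷ k ∷ []

  -- A vector is read as a monomial in four variables; these are the two rows of `curve k`, without
  -- the trivial terms that `ndot` produces.
  degree weight : Vec ℕ 4 → ℕ
  degree (a ∷ b ∷ c ∷ d ∷ []) = a + b + c + d
  weight (a ∷ b ∷ c ∷ d ∷ []) = b + suc k * c + suc (suc k) * d

  ndot-ones : ∀ w → ndot ones w ≡ degree w
  ndot-ones (a ∷ b ∷ c ∷ d ∷ []) = lemma a b c d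
    where
    lemma : ∀ a b c d → 1 * a + (1 * b + (1 * c + (1 * d + 0))) ≡ a + b + c + d
    lemma = ℕSolver.solve-∀

  ndot-exponents : ∀ w → ndot (exponents k) w ≡ weight w
  ndot-exponents (a ∷ b ∷ c ∷ d ∷ []) = lemma k a b c d
    where
    lemma : ∀ k a b c d → 0 * a + (1 * b + (suc k * c + (suc (suc k) * d + 0))) ≡
                          b + suc k * c + suc (suc k) * d
    lemma = ℕSolver.solve-∀

  ker⁺ : ∀ w u → degree w ≡ degree u → weight w ≡ weight u → InKer (curve k) (diff w u)
  ker⁺ w u deg wt = cong₂ _∷_
    (ndot≡⇒dot≡0 ones w u (trans (ndot-ones w) (trans deg (sym (ndot-ones u)))))
    (cong (_∷ []) (ndot≡⇒dot≡0 (exponents k) w u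
      (trans (ndot-exponents w) (trans wt (sym (ndot-exponents u))))))

  ker⁻ : ∀ w u → InKer (curve k) (diff w u) → degree w ≡ degree u × weight w ≡ weight u
  ker⁻ w u inKer with deg , rest ← VecP.∷-injective inKer =
    trans (sym (ndot-ones w)) (trans (dot≡0⇒ndot≡ ones w u deg) (ndot-ones u)) ,
    trans (sym (ndot-exponents w))
      (trans (dot≡0⇒ndot≡ (exponents k) w u (VecP.∷-injectiveˡ rest)) (ndot-exponents u))

  -- Reversal sends each exponent e to k + 2 - e. The identity is stated as a sum to stay in ℕ; it
  -- exchanges the roles of s and t.
  weight-reverse : ∀ a b c d → weight (d ∷ c ∷ b ∷ a ∷ []) + weight (a ∷ b ∷ c ∷ d ∷ []) ≡
                               suc (suc k) * degree (a ∷ b ∷ c ∷ d ∷ [])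
  weight-reverse = lemma k
    where
    lemma : ∀ k a b c d → (c + suc k * b + suc (suc k) * a) + (b + suc k * c + suc (suc k) * d) ≡
                          suc (suc k) * (a + b + c + d)
    lemma = ℕSolver.solve-∀

  degree-reverse : ∀ a b c d → degree (d ∷ c ∷ b ∷ a ∷ []) ≡ degree (a ∷ b ∷ c ∷ d ∷ [])
  degree-reverse = lemma
    where
    lemma : ∀ a b c d → d + c + b + a ≡ a + b + c + d
    lemma = ℕSolver.solve-∀

  -- A positive d contributes at least k + 2 to the weight and c ≥ 2 at least 2(k + 1), both beyond
  -- k + 1. For c = 0 and c = 1 the weight determines b and the degree then determines a.
  s-monomials : ∀ a b c d → degree (a ∷ b ∷ c ∷ d ∷ []) ≡ suc k →
                weight (a ∷ b ∷ c ∷ d ∷ []) ≡ suc k →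
                (a ∷ b ∷ c ∷ d ∷ [] ≡ s⁺) ⊎ (a ∷ b ∷ c ∷ d ∷ [] ≡ s⁻)
  s-monomials a b c (suc d) deg wt = contradiction (trans (sym wt) (lemma k b c d)) (ℕP.m≢1+m+n (suc k))
    where
    lemma : ∀ k b c d → b + suc k * c + suc (suc k) * suc d ≡ suc (suc k + (b + suc k * c + suc (suc k) * d))
    lemma = ℕSolver.solve-∀
  s-monomials a b 0 0 deg wt = inj₁ (cong₂ (λ a b → a ∷ b ∷ 0 ∷ 0 ∷ []) a≡0 b≡1+k)
    where
    lemma : ∀ k b → b + suc k * 0 + suc (suc k) * 0 ≡ b
    lemma = ℕSolver.solve-∀
    lemma′ : ∀ a b → a + b + 0 + 0 ≡ a + b
    lemma′ = ℕSolver.solve-∀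
    b≡1+k = trans (sym (lemma k b)) wt
    a≡0 = ℕP.+-cancelʳ-≡ (suc k) a 0
      (trans (cong (λ x → a + x) (sym b≡1+k)) (trans (sym (lemma′ a b)) deg))
  s-monomials a b 1 0 deg wt = inj₂ (cong₂ (λ a b → a ∷ b ∷ 1 ∷ 0 ∷ []) a≡k b≡0)
    where
    lemma : ∀ k b → b + suc k * 1 + suc (suc k) * 0 ≡ b + suc k
    lemma = ℕSolver.solve-∀
    lemma′ : ∀ a b → a + b + 1 + 0 ≡ suc (a + b)
    lemma′ = ℕSolver.solve-∀
    b≡0 = ℕP.+-cancelʳ-≡ (suc k) b 0 (trans (sym (lemma k b)) wt)
    a≡k = trans (sym (ℕP.+-identityʳ a))
      (trans (cong (λ x → a + x) (sym b≡0)) (ℕP.suc-injective (trans (sym (lemma′ a b)) deg)))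
  s-monomials a b (suc (suc c)) 0 deg wt = contradiction (trans (sym wt) (lemma k b c)) (ℕP.m≢1+m+n (suc k))
    where
    lemma : ∀ k b c → b + suc k * suc (suc c) + suc (suc k) * 0 ≡ suc (suc k + (k + b + suc k * c))
    lemma = ℕSolver.solve-∀

  p-monomials : ∀ a b c d → degree (a ∷ b ∷ c ∷ d ∷ []) ≡ 2 →
                weight (a ∷ b ∷ c ∷ d ∷ []) ≡ suc (suc k) →
                (a ∷ b ∷ c ∷ d ∷ [] ≡ p⁺) ⊎ (a ∷ b ∷ c ∷ d ∷ [] ≡ p⁻)
  p-monomials a b 0 0 deg wt =
    -- Here the weight gives b = k + 2, so degree 2 forces a + k = 0.
    contradiction
      (ℕP.m+n≡0⇒n≡0 a (ℕP.+-cancelˡ-≡ 2 _ 0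
        (trans (lemma′ k a) (trans (cong (λ b → a + b + 0 + 0) (trans (sym wt) (lemma k b))) deg)))) k≢0
    where
    lemma : ∀ k b → b + suc k * 0 + suc (suc k) * 0 ≡ b
    lemma = ℕSolver.solve-∀
    lemma′ : ∀ k a → 2 + (a + k) ≡ a + suc (suc k) + 0 + 0
    lemma′ = ℕSolver.solve-∀
  p-monomials a b 1 0 deg wt = inj₂ (cong₂ (λ a b → a ∷ b ∷ 1 ∷ 0 ∷ []) a≡0 b≡1)
    where
    lemma : ∀ k b → b + suc k * 1 + suc (suc k) * 0 ≡ b + suc k
    lemma = ℕSolver.solve-∀
    lemma′ : ∀ a b → a + suc b ≡ a + b + 1 + 0
    lemma′ = ℕSolver.solve-∀
    b≡1 = ℕP.+-cancelʳ-≡ (suc k) b 1 (trans (sym (lemma k b)) wt)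
    a≡0 = ℕP.+-cancelʳ-≡ 2 a 0 (trans (cong (λ b → a + suc b) (sym b≡1)) (trans (lemma′ a b) deg))
  p-monomials a b (suc (suc c)) 0 deg wt =
    -- Already c = 2 gives weight 2(k + 1) = k + (k + 2), too large as k is nonzero.
    contradiction
      (ℕP.m+n≡0⇒m≡0 k (ℕP.+-cancelʳ-≡ (suc (suc k)) _ 0 (trans (sym (lemma k b c)) wt))) k≢0
    where
    lemma : ∀ k b c → b + suc k * suc (suc c) + suc (suc k) * 0 ≡ k + (b + suc k * c) + suc (suc k)
    lemma = ℕSolver.solve-∀
  p-monomials a b c 1 deg wt
    with b+c*≡0 ← ℕP.+-cancelʳ-≡ (suc (suc k)) (b + suc k * c) 0
           (trans (cong (λ x → b + suc k * c + x) (sym (ℕP.*-identityʳ (suc (suc k))))) wt)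
    with refl ← ℕP.m+n≡0⇒m≡0 b b+c*≡0
    with refl ← ℕP.m+n≡0⇒m≡0 c b+c*≡0
    with refl ← ℕP.+-cancelʳ-≡ 1 a 1
           (trans (cong (_+ 1) (sym (trans (ℕP.+-identityʳ (a + 0)) (ℕP.+-identityʳ a)))) deg) = inj₁ refl
  p-monomials a b c (suc (suc d)) deg wt = contradiction (trans (sym wt) (lemma k b c d)) (ℕP.m≢1+m+n (suc (suc k)))
    where
    lemma : ∀ k b c d → b + suc k * c + suc (suc k) * suc (suc d) ≡
                        suc (suc (suc k) + (suc k + b + suc k * c + suc (suc k) * d))
    lemma = ℕSolver.solve-∀

  s-fibre : ∀ z → InKer (curve k) (diff s⁺ z) → z ≡ s⁺ ⊎ z ≡ s⁻
  s-fibre z@(a ∷ b ∷ c ∷ d ∷ []) inKer with deg , wt ← ker⁻ s⁺ z inKer =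
    s-monomials a b c d (trans (sym deg) (lemma k)) (trans (sym wt) (lemma′ k))
    where
    lemma : ∀ k → 0 + suc k + 0 + 0 ≡ suc k
    lemma = ℕSolver.solve-∀
    lemma′ : ∀ k → suc k + suc k * 0 + suc (suc k) * 0 ≡ suc k
    lemma′ = ℕSolver.solve-∀

  -- Reversal carries `s⁺` to `t⁺` and `s⁻` to `t⁻`. The reversed weight is (k + 2)(k + 1) - (k +
  -- 1)² = k + 1, so `s-monomials` applies.
  t-fibre : ∀ z → InKer (curve k) (diff t⁺ z) → z ≡ t⁺ ⊎ z ≡ t⁻
  t-fibre z@(a ∷ b ∷ c ∷ d ∷ []) inKer with deg , wt ← ker⁻ t⁺ z inKer =
    Sum.map (cong Vec.reverse) (cong Vec.reverse)
      (s-monomials d c b a (trans (degree-reverse a b c d) deg≡1+k)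
        (ℕP.+-cancelʳ-≡ (weight (a ∷ b ∷ c ∷ d ∷ [])) _ _
          (trans (weight-reverse a b c d)
            (trans (cong (suc (suc k) *_) deg≡1+k) (trans (lemma k) (cong (λ x → suc k + x) wt))))))
    where
    deg≡1+k : degree (a ∷ b ∷ c ∷ d ∷ []) ≡ suc k
    deg≡1+k = trans (sym (proj₁ (ker⁻ t⁺ z inKer))) (ℕP.+-identityʳ (suc k))
    lemma : ∀ k → suc (suc k) * suc k ≡ suc k + (0 + suc k * suc k + suc (suc k) * 0)
    lemma = ℕSolver.solve-∀

  p-fibre : ∀ z → InKer (curve k) (diff p⁺ z) → z ≡ p⁺ ⊎ z ≡ p⁻
  p-fibre z@(a ∷ b ∷ c ∷ d ∷ []) inKer with deg , wt ← ker⁻ p⁺ z inKer =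
    p-monomials a b c d (sym deg) (trans (sym wt) (lemma k))
    where
    lemma : ∀ k → 0 + suc k * 0 + suc (suc k) * 1 ≡ suc (suc k)
    lemma = ℕSolver.solve-∀

  -- The witness c counts the rows equal to `p⁺`: these have 1 in the first and last columns, where
  -- `p⁻` has 0. The extreme counts m and 0 determine all rows.
  outerCounts : ∀ {m} {zs : Vec (Vec ℕ 4) m} → VAll.All (λ z → z ≡ p⁺ ⊎ z ≡ p⁻) zs →
    ∃[ c ] (c ≤ m × (lookup (rowTotal zs) (# 0) ≡ c) × (lookup (rowTotal zs) (# 3) ≡ c) ×
            (c ≡ m → zs ≡ replicate m p⁺) × (c ≡ 0 → zs ≡ replicate m p⁻))
  outerCounts [] = 0 , ℕ.z≤n , refl , refl , (λ _ → refl) , (λ _ → refl)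
  outerCounts {zs = z ∷ zs} (q ∷ qs) with c , c≤m , first , fourth , full , none ← outerCounts qs | q
  ... | inj₁ refl = suc c , ℕ.s≤s c≤m ,
        trans (VecP.lookup-zipWith _+_ (# 0) p⁺ (rowTotal zs)) (cong suc first) ,
        trans (VecP.lookup-zipWith _+_ (# 3) p⁺ (rowTotal zs)) (cong suc fourth) ,
        (λ eq → cong (p⁺ ∷_) (full (ℕP.suc-injective eq))) , λ ()
  ... | inj₂ refl = c , ℕP.m≤n⇒m≤1+n c≤m ,
        trans (VecP.lookup-zipWith _+_ (# 0) p⁻ (rowTotal zs)) first ,
        trans (VecP.lookup-zipWith _+_ (# 3) p⁻ (rowTotal zs)) fourth ,
        -- With a `p⁻` at the head the count cannot reach the full length; this is what the bound
        -- `c ≤ m` is carried for.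
        (λ { refl → contradiction c≤m ℕP.1+n≰n }) , λ eq → cong (p⁻ ∷_) (none eq)

  rowTotal-replicate : ∀ m {n} (x : Vec ℕ n) → rowTotal (replicate m x) ≡ Vec.map (m *_) x
  rowTotal-replicate zero    x = sym (VecP.map-const x 0)
  rowTotal-replicate (suc m) x = trans (cong (x ⊞_) (rowTotal-replicate m x)) (⊞-map x)
    where
    ⊞-map : ∀ {n} (x : Vec ℕ n) → x ⊞ Vec.map (m *_) x ≡ Vec.map (suc m *_) x
    ⊞-map []      = refl
    ⊞-map (a ∷ x) = cong (_ ∷_) (⊞-map x)

  source target : Vec (Vec ℕ 4) (2 + k)
  source = s⁺ ∷ t⁺ ∷ replicate k p⁺
  target = s⁻ ∷ t⁻ ∷ replicate k p⁻

  All-replicate : ∀ {A : Set} {P : A → Set} n {x} → P x → VAll.All P (replicate n x)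
  All-replicate zero    p = []
  All-replicate (suc n) p = p ∷ All-replicate n p

  All-source-target : {P : ZVec 4 → Set} → P (diff s⁺ s⁻) → P (diff t⁺ t⁻) → P (diff p⁺ p⁻) →
                      VAll.All P (zipWith diff source target)
  All-source-target ps pt pp =
    ps ∷ pt ∷ subst (VAll.All _) (sym (VecP.zipWith-replicate diff p⁺ p⁻)) (All-replicate k pp)

  -- The equations `col₁` to `col₄` are the coordinates of s + t + k p = 0, with negative terms
  -- moved to the other side.
  sameFibre : SameFibre (curve k) source target
  sameFibre = All-source-target (ker⁺ s⁺ s⁻ (deg₁ k) (wt₁ k)) (ker⁺ t⁺ t⁻ (deg₂ k) (wt₂ k))
                                (ker⁺ p⁺ p⁻ refl (wt₃ k)) ,
    trans (cong (λ x → s⁺ ⊞ (t⁺ ⊞ x)) (rowTotal-replicate k p⁺))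
      (trans (cong₂ _∷_ (col₁ k) (cong₂ _∷_ (col₂ k) (cong₂ _∷_ (col₃ k) (cong₂ _∷_ (col₄ k) refl))))
        (cong (λ x → s⁻ ⊞ (t⁻ ⊞ x)) (sym (rowTotal-replicate k p⁻))))
    where
    deg₁ : ∀ k → 0 + suc k + 0 + 0 ≡ k + 0 + 1 + 0
    deg₁ = ℕSolver.solve-∀
    wt₁ : ∀ k → suc k + suc k * 0 + suc (suc k) * 0 ≡ 0 + suc k * 1 + suc (suc k) * 0
    wt₁ = ℕSolver.solve-∀
    deg₂ : ∀ k → 0 + 0 + suc k + 0 ≡ 0 + 1 + 0 + k
    deg₂ = ℕSolver.solve-∀
    wt₂ : ∀ k → 0 + suc k * suc k + suc (suc k) * 0 ≡ 1 + suc k * 0 + suc (suc k) * k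
    wt₂ = ℕSolver.solve-∀
    wt₃ : ∀ k → 0 + suc k * 0 + suc (suc k) * 1 ≡ 1 + suc k * 1 + suc (suc k) * 0
    wt₃ = ℕSolver.solve-∀
    col₁ : ∀ k → 0 + (0 + k * 1) ≡ k + (0 + k * 0)
    col₁ = ℕSolver.solve-∀
    col₂ : ∀ k → suc k + (0 + k * 0) ≡ 0 + (1 + k * 1)
    col₂ = ℕSolver.solve-∀
    col₃ : ∀ k → 0 + (suc k + k * 0) ≡ 1 + (0 + k * 1)
    col₃ = ℕSolver.solve-∀
    col₄ : ∀ k → 0 + (0 + k * 1) ≡ 0 + (k + k * 0)
    col₄ = ℕSolver.solve-∀

  -- Each row has two choices, and the first and last columns total k. The first column holds c,
  -- plus k exactly when z is `s⁻`; the last holds c, plus k exactly when y is `t⁻`. So c is k or 0,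
  -- and it settles z, y and the remaining rows together.
  source-fibre : ∀ zs → SameFibre (curve k) source zs → zs ≡ source ⊎ zs ≡ target
  source-fibre (z ∷ y ∷ zs) (kz ∷ ky ∷ kzs , totals)
    with c , _ , first , fourth , full , none ← outerCounts
           (VAll.map (λ {x} → p-fibre x) (VAllP.map⁻
             (subst (VAll.All (InKer (curve k))) (VecP.zipWith-replicate₁ diff p⁺ zs) kzs)))
    = decide (s-fibre z kz) (t-fibre y ky)
        (trans (column (# 0)) (cong (λ x → lookup z (# 0) + (lookup y (# 0) + x)) first))
        (trans (column (# 3)) (cong (λ x → lookup z (# 3) + (lookup y (# 3) + x)) fourth))
    where
    column : ∀ i → lookup s⁺ i + (lookup t⁺ i + lookup (Vec.map (k *_) p⁺) i) ≡
                   lookup z i + (lookup y i + lookup (rowTotal zs) i)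
    column i = begin
      lookup s⁺ i + (lookup t⁺ i + lookup (Vec.map (k *_) p⁺) i)
        ≡⟨ cong (λ x → lookup s⁺ i + (lookup t⁺ i + lookup x i)) (rowTotal-replicate k p⁺) ⟨
      lookup s⁺ i + (lookup t⁺ i + lookup (rowTotal (replicate k p⁺)) i)
        ≡⟨ lookup-⊞⊞ s⁺ t⁺ (rowTotal (replicate k p⁺)) ⟨
      lookup (rowTotal source) i
        ≡⟨ cong (λ x → lookup x i) totals ⟩
      lookup (rowTotal (z ∷ y ∷ zs)) i
        ≡⟨ lookup-⊞⊞ z y (rowTotal zs) ⟩
      lookup z i + (lookup y i + lookup (rowTotal zs) i) ∎
      where
      open ≡-Reasoning
      lookup-⊞⊞ : ∀ u v w → lookup (u ⊞ (v ⊞ w)) i ≡ lookup u i + (lookup v i + lookup w i)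
      lookup-⊞⊞ u v w = trans (VecP.lookup-zipWith _+_ i u (v ⊞ w))
        (cong (λ x → lookup u i + x) (VecP.lookup-zipWith _+_ i v w))

    simplify : ∀ {x} → k * 1 ≡ x → k ≡ x
    simplify = trans (sym (ℕP.*-identityʳ k))

    vanish : ∀ {x} → k * 1 ≡ k + x → x ≡ 0
    vanish eq = ℕP.+-cancelˡ-≡ k _ 0 (trans (sym eq) (trans (ℕP.*-identityʳ k) (sym (ℕP.+-identityʳ k))))

    decide : z ≡ s⁺ ⊎ z ≡ s⁻ → y ≡ t⁺ ⊎ y ≡ t⁻ →
             k * 1 ≡ lookup z (# 0) + (lookup y (# 0) + c) →
             k * 1 ≡ lookup z (# 3) + (lookup y (# 3) + c) →
             z ∷ y ∷ zs ≡ source ⊎ z ∷ y ∷ zs ≡ target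
    decide (inj₁ refl) (inj₁ refl) k≡c _ =
      inj₁ (cong (λ x → s⁺ ∷ t⁺ ∷ x) (full (sym (simplify k≡c))))
    -- In the mixed cases one column gives c = k and the other c = 0.
    decide (inj₁ refl) (inj₂ refl) k≡c k≡k+c = contradiction (trans (simplify k≡c) (vanish k≡k+c)) k≢0
    decide (inj₂ refl) (inj₁ refl) k≡k+c k≡c = contradiction (trans (simplify k≡c) (vanish k≡k+c)) k≢0
    decide (inj₂ refl) (inj₂ refl) k≡k+c _ =
      inj₂ (cong (λ x → s⁻ ∷ t⁻ ∷ x) (none (vanish k≡k+c)))

  rows-nonzero : VAll.All (_≢ 0ᵥ) (zipWith diff source target)
  -- The chosen coordinates are all -1, so they are nonzero independently of k.
  rows-nonzero = All-source-target (nonzero (# 2) λ ()) (nonzero (# 1) λ ()) (nonzero (# 1) λ ())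
    where
    nonzero : ∀ {x : ZVec 4} i → lookup x i ≢ lookup 0ᵥ i → x ≢ 0ᵥ
    nonzero i xᵢ≢0 refl = xᵢ≢0 refl

  move : ZVec ((2 + k) * 4)
  move = diff (concat source) (concat target)

  type-move : type {4} (2 + k) move ≡ 2 + k
  type-move = type-full source target rows-nonzero

  move-universal : InUniversalMarkovBasis (lawrence (2 + k) (curve k)) move
  move-universal = Minimal.indispensable-universal (lawrence (2 + k) (curve k))
    (lawrence-graded (2 + k) (curve k)) (concat source) (concat target)
    (sameFibre⁺ (curve k) source target sameFibre) source≢target fibre
    where
    source≢target : concat source ≢ concat target
    source≢target eq with () ← cong (λ x → lookup x (# 2)) eq

    fibre : ∀ x → InKer (lawrence (2 + k) (curve k)) (diff (concat source) x) →
            x ≡ concat source ⊎ x ≡ concat target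
    fibre x inKer with zs , refl ← Vec.group (2 + k) 4 x =
      Sum.map (cong concat) (cong concat) (source-fibre zs (sameFibre⁻ (curve k) source zs inKer))

theorem5p1 : (N : ℕ) → 1 ≤ N →
    Σ (Matrix 2 4) λ A →
    ∃[ r ] (2 ≤ r × ∃[ v ] (InUniversalMarkovBasis (lawrence r A) v × N ≤ type r v))
-- Taking k = N gives type N + 2, and positivity of N supplies k ≠ 0.
theorem5p1 N 1≤N = curve N , 2 ℕ.+ N , ℕP.m≤m+n 2 N , move , move-universal ,
  ℕP.≤-trans (ℕP.m≤n+m N 2) (ℕP.≤-reflexive (sym type-move))
  where open Witness N (ℕP.>⇒≢ 1≤N)
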